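{- For every $n\in\mathbb N$ we have (i) $\displaystyle\sum_{k=0}^{[n/2]}\binom n{2k}(2^{n-2k}-1)U_{2k}=1-U_n$; (ii) $\displaystyle\sum_{k=0}^{[(n-1)/2]}\binom n{2k}6^{n-2k}U_{2k}=5^n+4^n-2^n-1$; (iii) $\displaystyle U_{2n}=1+2^{2n}-\sum_{k=0}^n\binom{2n}{2k}3^{2n-2k}U_{2k}$; (iv) $\displaystyle U_{2n}=2(-1)^n-4\sum_{k=1}^{[n/2]}\binom{2n}{4k}\left((-4)^k-1\right)U_{2n-4k}$; (v) $\displaystyle U_{2n}=4^{n-1}+\frac{1+V_{2n}}4-\frac34\sum_{k=1}^{[n/3]}\binom{2n}{6k}3^{6k}U_{2n-6k}$, where $\{V_m\}$ is given by $V_0=2$, $V_1=1$ and $V_{m+1}=V_m-7V_{m-1}$ for $m\ge1$.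
   Context: $\mathbb N$ is the set of positive integers; $[x]$ is the greatest integer not exceeding $x$. The sequence $\{U_n\}_{n\ge0}$ is defined by $U_0=1$ and $U_n=-2\sum_{k=1}^{[n/2]}\binom n{2k}U_{n-2k}$ for $n\ge1$. -}

module Defs where

open import Data.Nat.Base as ℕ using (ℕ; zero; suc; s≤s)
open import Data.Nat.Properties using (m∸n≤m)
open import Data.Nat.Combinatorics using (_C_)
open import Data.Nat.Induction using (<-Rec; <-rec; <-wellFounded)
open import Data.Integer.Base using (ℤ; +_; -_; 0ℤ; 1ℤ; _+_; _-_; _*_)
open import Induction.WellFounded using (module FixPoint)
open import Relation.Binary.PropositionalEquality using (_≡_; refl; cong; cong₂)

∑< : ℕ → (ℕ → ℤ) → ℤ
∑< zero    f = 0ℤ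
∑< (suc n) f = ∑< n f + f n

-- f a + f (a + 1) + ⋯ + f b, which is 0 when b < a.
∑ : ℕ → ℕ → (ℕ → ℤ) → ℤ
∑ a b f = ∑< (suc b ℕ.∸ a) (λ i → f (a ℕ.+ i))

syntax ∑ a b (λ k → t) = ∑[ k from a to b ] t

∑<-cong : ∀ n {f g : ℕ → ℤ} → (∀ i → f i ≡ g i) → ∑< n f ≡ ∑< n g
∑<-cong zero    f≗g = refl
∑<-cong (suc n) f≗g = cong₂ _+_ (∑<-cong n f≗g) (f≗g n)

-- The summation index k ≥ 1 is written suc i, so that n ∸ 2k < n;
-- U-rec below is the recurrence in its usual form.
U-step : ∀ n → <-Rec (λ _ → ℤ) n → ℤ
U-step zero      rec = 1ℤ
U-step n@(suc m) rec = - (+ 2) * ∑< (n ℕ./ 2) term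
  where
  term : ℕ → ℤ
  term i = + (n C (2 ℕ.* suc i)) * rec {n ℕ.∸ 2 ℕ.* suc i} (s≤s (m∸n≤m m (i ℕ.+ 1 ℕ.* suc i)))

U : ℕ → ℤ
U = <-rec (λ _ → ℤ) U-step

U-zero : U 0 ≡ 1ℤ
U-zero = refl

U-rec : ∀ n → 1 ℕ.≤ n →
        U n ≡ - (+ 2) * (∑[ k from 1 to n ℕ./ 2 ] (+ (n C (2 ℕ.* k)) * U (n ℕ.∸ 2 ℕ.* k)))
U-rec n@(suc _) _ = unfold-wfRec {n}
  where
  U-step-ext : ∀ n {r s : <-Rec (λ _ → ℤ) n} →
               (∀ {m} m<n → r {m} m<n ≡ s m<n) → U-step n r ≡ U-step n s
  U-step-ext zero      r≗s = refl
  U-step-ext n@(suc _) r≗s =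
    cong (- (+ 2) *_) (∑<-cong (n ℕ./ 2) λ i → cong (+ (n C (2 ℕ.* suc i)) *_) (r≗s {n ℕ.∸ 2 ℕ.* suc i} _))

  open FixPoint <-wellFounded (λ _ → ℤ) U-step (λ n r≗s → U-step-ext n r≗s)

V : ℕ → ℤ
V 0             = + 2
V 1             = + 1
V (suc (suc m)) = V (suc m) - + 7 * V m

{-# OPTIONS --safe #-}
module Submission where

-- In terms of exponential generating functions U is 1 / (eˣ + e⁻ˣ − 1). Convolution with the sequence
-- aⁿ multiplies by eᵃˣ, so for every sequence f
--   U ⋆ (eˣ f) + U ⋆ (e⁻ˣ f) = U ⋆ f + f.
-- With t = eˣ, (i)–(iii) follow from divisibility of polynomials by t² − t + 1, for example
-- t³ + 1 = (t + 1)(t² − t + 1). For (iv) and (v) the relation is applied to f = iⁿ + (−i)ⁿ and to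
-- f = Vₙ, (−1)ⁿVₙ: the roots of their characteristic polynomials, suitably shifted by ±1, are fourth
-- roots of −4 and sixth roots of 3⁶, whose power sums vanish off the multiples of 4 and 6.

open import Defs
open import Data.Nat.Base as ℕ using (ℕ; zero; suc; z≤n; s≤s)
open import Data.Nat.Combinatorics using (_C_; nCk+nC[k+1]≡[n+1]C[k+1]; k>n⇒nCk≡0; nCn≡1)
open import Data.Nat.Divisibility using (divides-refl)
import Data.Nat.DivMod as ℕ
open import Data.Nat.Induction using (<-rec)
import Data.Nat.Properties as ℕₚ
open import Data.Integer.Base using (ℤ; +_; -_; _+_; _-_; _*_; _^_; 0ℤ; 1ℤ)
open import Data.Integer.Properties
open import Data.Integer.Tactic.RingSolver using (solve-∀)
open import Data.Rational.Base as ℚ using (_/_; toℚᵘ)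
import Data.Rational.Properties as ℚₚ
open import Data.Rational.Unnormalised.Base as ℚᵘ using (mkℚᵘ; *≡*; _≃_)
import Data.Rational.Unnormalised.Properties as ℚᵘₚ
open import Data.Product.Base using (_×_; _,_)
open import Algebra.Properties.AbelianGroup +-0-abelianGroup using (∙-cancelʳ)
open import Function.Base using (_∘_)
open import Relation.Binary.PropositionalEquality
open ≡-Reasoning

-- Finite sums of integers.

+-congˡ : ∀ a {b c} → b ≡ c → a + b ≡ a + c
+-congˡ a b≡c = cong (λ x → a + x) b≡c

interchange : ∀ a b c d → (a + b) + (c + d) ≡ (a + c) + (b + d)
interchange = solve-∀

∑<-cong-< : ∀ n {f g} → (∀ i → i ℕ.< n → f i ≡ g i) → ∑< n f ≡ ∑< n g
∑<-cong-< zero    f≗g = refl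
∑<-cong-< (suc n) f≗g =
  cong₂ _+_ (∑<-cong-< n λ i i<n → f≗g i (ℕₚ.m<n⇒m<1+n i<n)) (f≗g n ℕₚ.≤-refl)

∑<-zero : ∀ n → ∑< n (λ _ → 0ℤ) ≡ 0ℤ
∑<-zero zero    = refl
∑<-zero (suc n) = cong (_+ 0ℤ) (∑<-zero n)

∑<-+ : ∀ n f g → ∑< n (λ i → f i + g i) ≡ ∑< n f + ∑< n g
∑<-+ zero    f g = refl
∑<-+ (suc n) f g = trans (cong (_+ (f n + g n)) (∑<-+ n f g)) (interchange (∑< n f) (∑< n g) (f n) (g n))

∑<-* : ∀ n c f → ∑< n (λ i → c * f i) ≡ c * ∑< n f
∑<-* zero    c f = sym (*-zeroʳ c)
∑<-* (suc n) c f = trans (cong (_+ c * f n) (∑<-* n c f)) (sym (*-distribˡ-+ c _ _))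

∑<-++ : ∀ m n f → ∑< (m ℕ.+ n) f ≡ ∑< m f + ∑< n (λ i → f (m ℕ.+ i))
∑<-++ m zero    f = trans (cong (λ k → ∑< k f) (ℕₚ.+-identityʳ m)) (sym (+-identityʳ _))
∑<-++ m (suc n) f = begin
  ∑< (m ℕ.+ suc n) f                             ≡⟨ cong (λ k → ∑< k f) (ℕₚ.+-suc m n) ⟩
  ∑< (m ℕ.+ n) f + f (m ℕ.+ n)                   ≡⟨ cong (_+ f (m ℕ.+ n)) (∑<-++ m n f) ⟩
  ∑< m f + ∑< n (f ∘ (m ℕ.+_)) + f (m ℕ.+ n)     ≡⟨ +-assoc (∑< m f) _ _ ⟩
  ∑< m f + ∑< (suc n) (f ∘ (m ℕ.+_))             ∎

∑<-head : ∀ n f → ∑< (suc n) f ≡ f 0 + ∑< n (f ∘ suc)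
∑<-head n f = trans (∑<-++ 1 n f) (cong (_+ ∑< n (f ∘ suc)) (+-identityˡ (f 0)))

∑<-vanish : ∀ n {f} → (∀ i → i ℕ.< n → f i ≡ 0ℤ) → ∑< n f ≡ 0ℤ
∑<-vanish n f≡0 = trans (∑<-cong-< n f≡0) (∑<-zero n)

-- The range splits into `m` blocks of length `suc d`, and only the head of each block survives.
-- Writing the modulus as `suc d` lets `∑<-head` detach that head.
∑<-multiples : ∀ d m f → (∀ j r → r ℕ.< d → f (suc d ℕ.* j ℕ.+ suc r) ≡ 0ℤ) →
               ∑< (suc d ℕ.* m) f ≡ ∑< m (λ j → f (suc d ℕ.* j))
∑<-multiples d zero    f f≡0 = cong (λ k → ∑< k f) (ℕₚ.*-zeroʳ d)
∑<-multiples d (suc m) f f≡0 = begin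
  ∑< (suc d ℕ.* suc m) f
    ≡⟨ cong (λ k → ∑< k f) (trans (ℕₚ.*-suc (suc d) m) (ℕₚ.+-comm (suc d) _)) ⟩
  ∑< (suc d ℕ.* m ℕ.+ suc d) f
    ≡⟨ ∑<-++ (suc d ℕ.* m) (suc d) f ⟩
  ∑< (suc d ℕ.* m) f + ∑< (suc d) (λ i → f (suc d ℕ.* m ℕ.+ i))
    ≡⟨ cong₂ _+_ (∑<-multiples d m f f≡0) block ⟩
  ∑< m (λ j → f (suc d ℕ.* j)) + f (suc d ℕ.* m) ∎
  where
  block : ∑< (suc d) (λ i → f (suc d ℕ.* m ℕ.+ i)) ≡ f (suc d ℕ.* m)
  block = begin
    ∑< (suc d) (λ i → f (suc d ℕ.* m ℕ.+ i))
      ≡⟨ ∑<-head d (λ i → f (suc d ℕ.* m ℕ.+ i)) ⟩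
    f (suc d ℕ.* m ℕ.+ 0) + ∑< d (λ i → f (suc d ℕ.* m ℕ.+ suc i))
      ≡⟨ cong₂ _+_ (cong f (ℕₚ.+-identityʳ _)) (∑<-vanish d (f≡0 m)) ⟩
    f (suc d ℕ.* m) + 0ℤ
      ≡⟨ +-identityʳ _ ⟩
    f (suc d ℕ.* m) ∎

∑<-extend : ∀ {m n} f → m ℕ.≤ n → (∀ k → m ℕ.≤ k → f k ≡ 0ℤ) → ∑< m f ≡ ∑< n f
∑<-extend {m} {n} f m≤n f≡0 = sym (begin
  ∑< n f                                   ≡⟨ cong (λ k → ∑< k f) (sym (ℕₚ.m+[n∸m]≡n m≤n)) ⟩
  ∑< (m ℕ.+ (n ℕ.∸ m)) f                   ≡⟨ ∑<-++ m (n ℕ.∸ m) f ⟩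
  ∑< m f + ∑< (n ℕ.∸ m) (f ∘ (m ℕ.+_))     ≡⟨ +-congˡ (∑< m f) (∑<-vanish (n ℕ.∸ m) λ i _ → f≡0 (m ℕ.+ i) (ℕₚ.m≤m+n m i)) ⟩
  ∑< m f + 0ℤ                              ≡⟨ +-identityʳ _ ⟩
  ∑< m f                                   ∎)

-- Sequences under binomial convolution: a commutative algebra with derivation `D`.

Seq : Set
Seq = ℕ → ℤ

infixl 6 _⊕_
infixl 7 _⊙_ _⋆_

D : Seq → Seq
D f n = f (suc n)

_⊕_ : Seq → Seq → Seq
(f ⊕ g) n = f n + g n

_⊙_ : ℤ → Seq → Seq
(c ⊙ f) n = c * f n

-- The product of exponential generating functions, given by the Leibniz rule; ⋆-sum is its binomial form.
_⋆_ : Seq → Seq → Seq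
(f ⋆ g) zero    = f 0 * g 0
(f ⋆ g) (suc n) = (D f ⋆ g) n + (f ⋆ D g) n

⋆-cong : ∀ {f f′ g g′} → f ≗ f′ → g ≗ g′ → f ⋆ g ≗ f′ ⋆ g′
⋆-cong p q zero    = cong₂ _*_ (p 0) (q 0)
⋆-cong p q (suc n) = cong₂ _+_ (⋆-cong (p ∘ suc) q n) (⋆-cong p (q ∘ suc) n)

⋆-comm : ∀ f g → f ⋆ g ≗ g ⋆ f
⋆-comm f g zero    = *-comm (f 0) (g 0)
⋆-comm f g (suc n) =
  trans (cong₂ _+_ (⋆-comm (D f) g n) (⋆-comm f (D g) n)) (+-comm ((g ⋆ D f) n) _)

⋆-distribʳ : ∀ h f g → (f ⊕ g) ⋆ h ≗ f ⋆ h ⊕ g ⋆ h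
⋆-distribʳ h f g zero    = *-distribʳ-+ (h 0) (f 0) (g 0)
⋆-distribʳ h f g (suc n) =
  trans (cong₂ _+_ (⋆-distribʳ h (D f) (D g) n) (⋆-distribʳ (D h) f g n))
        (interchange ((D f ⋆ h) n) ((D g ⋆ h) n) ((f ⋆ D h) n) _)

⋆-distribˡ : ∀ h f g → h ⋆ (f ⊕ g) ≗ h ⋆ f ⊕ h ⋆ g
⋆-distribˡ h f g n = trans (⋆-comm h (f ⊕ g) n)
  (trans (⋆-distribʳ h f g n) (cong₂ _+_ (⋆-comm f h n) (⋆-comm g h n)))

⊙-⋆ : ∀ c f g → (c ⊙ f) ⋆ g ≗ c ⊙ (f ⋆ g)
⊙-⋆ c f g zero    = *-assoc c (f 0) (g 0)
⊙-⋆ c f g (suc n) =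
  trans (cong₂ _+_ (⊙-⋆ c (D f) g n) (⊙-⋆ c f (D g) n)) (sym (*-distribˡ-+ c ((D f ⋆ g) n) _))

⋆-⊙ : ∀ c f g → f ⋆ (c ⊙ g) ≗ c ⊙ (f ⋆ g)
⋆-⊙ c f g n = trans (⋆-comm f (c ⊙ g) n) (trans (⊙-⋆ c g f n) (cong (c *_) (⋆-comm g f n)))

-- Induction on the index with all three sequences free: both bracketings expand by the Leibniz rule
-- into the same three products, with `D` on one factor each.
⋆-assoc : ∀ f g h → (f ⋆ g) ⋆ h ≗ f ⋆ (g ⋆ h)
⋆-assoc f g h zero    = *-assoc (f 0) (g 0) (h 0)
⋆-assoc f g h (suc n) = begin
  ((D f ⋆ g ⊕ f ⋆ D g) ⋆ h) n + ((f ⋆ g) ⋆ D h) n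
    ≡⟨ cong (_+ ((f ⋆ g) ⋆ D h) n) (⋆-distribʳ h (D f ⋆ g) (f ⋆ D g) n) ⟩
  ((D f ⋆ g) ⋆ h) n + ((f ⋆ D g) ⋆ h) n + ((f ⋆ g) ⋆ D h) n
    ≡⟨ cong₂ _+_ (cong₂ _+_ (⋆-assoc (D f) g h n) (⋆-assoc f (D g) h n)) (⋆-assoc f g (D h) n) ⟩
  (D f ⋆ (g ⋆ h)) n + (f ⋆ (D g ⋆ h)) n + (f ⋆ (g ⋆ D h)) n
    ≡⟨ +-assoc ((D f ⋆ (g ⋆ h)) n) _ _ ⟩
  (D f ⋆ (g ⋆ h)) n + ((f ⋆ (D g ⋆ h)) n + (f ⋆ (g ⋆ D h)) n)
    ≡⟨ +-congˡ ((D f ⋆ (g ⋆ h)) n) (sym (⋆-distribˡ f (D g ⋆ h) (g ⋆ D h) n)) ⟩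
  (D f ⋆ (g ⋆ h)) n + (f ⋆ (D g ⋆ h ⊕ g ⋆ D h)) n ∎

conv-term : Seq → Seq → ℕ → Seq
conv-term f g n k = + (n C k) * (f k * g (n ℕ.∸ k))

conv-term-vanish : ∀ f g {n k} → n ℕ.< k → conv-term f g n k ≡ 0ℤ
conv-term-vanish f g {n} {k} n<k = cong (λ c → + c * (f k * g (n ℕ.∸ k))) (k>n⇒nCk≡0 n<k)

-- Pascal's rule: the k-th term of `D f ⋆ g` and the (k+1)-st term of `f ⋆ D g` carry the same
-- product of values, so their binomial coefficients add.
⋆-sum : ∀ f g n → (f ⋆ g) n ≡ ∑< (suc n) (conv-term f g n)
⋆-sum f g zero    = sym (trans (+-identityˡ (1ℤ * (f 0 * g 0))) (*-identityˡ (f 0 * g 0)))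
⋆-sum f g (suc n) = begin
  (D f ⋆ g) n + (f ⋆ D g) n
    ≡⟨ cong₂ _+_ (⋆-sum (D f) g n) (⋆-sum f (D g) n) ⟩
  A + ∑< (suc n) (conv-term f (D g) n)
    ≡⟨ +-congˡ A (∑<-cong-< (suc n) λ { k (s≤s k≤n) →
         cong (λ m → + (n C k) * (f k * g m)) (sym (ℕₚ.+-∸-assoc 1 k≤n)) }) ⟩
  A + ∑< (suc n) t
    -- The added term has binomial coefficient 0. With it, removing the head `t 0` leaves a sum of
    -- the same length as `A`.
    ≡⟨ +-congˡ A (∑<-extend t (ℕₚ.n≤1+n (suc n))
         λ k n<k → cong (λ c → + c * (f k * g (suc n ℕ.∸ k))) (k>n⇒nCk≡0 n<k)) ⟩
  A + ∑< (suc (suc n)) t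
    ≡⟨ +-congˡ A (∑<-head (suc n) t) ⟩
  A + (t 0 + ∑< (suc n) (t ∘ suc))
    ≡⟨ swap A (t 0) (∑< (suc n) (t ∘ suc)) ⟩
  t 0 + (A + ∑< (suc n) (t ∘ suc))
    ≡⟨ +-congˡ (t 0) (sym (∑<-+ (suc n) (conv-term (D f) g n) (t ∘ suc))) ⟩
  t 0 + ∑< (suc n) (λ k → conv-term (D f) g n k + t (suc k))
    ≡⟨ +-congˡ (t 0) (∑<-cong (suc n) pascal) ⟩
  conv-term f g (suc n) 0 + ∑< (suc n) (conv-term f g (suc n) ∘ suc)
    ≡⟨ sym (∑<-head (suc n) (conv-term f g (suc n))) ⟩
  ∑< (suc (suc n)) (conv-term f g (suc n)) ∎
  where
  A : ℤ
  A = ∑< (suc n) (conv-term (D f) g n)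

  t : Seq
  t k = + (n C k) * (f k * g (suc n ℕ.∸ k))

  swap : ∀ a b c → a + (b + c) ≡ b + (a + c)
  swap = solve-∀

  pascal : ∀ k → conv-term (D f) g n k + t (suc k) ≡ conv-term f g (suc n) (suc k)
  pascal k = trans (sym (*-distribʳ-+ (f (suc k) * g (n ℕ.∸ k)) (+ (n C k)) (+ (n C suc k))))
    (cong (λ c → + c * (f (suc k) * g (n ℕ.∸ k))) (nCk+nC[k+1]≡[n+1]C[k+1] n k))

-- This yields every sum with step 2, 4 or 6 below: a factor supported on multiples of `suc d` thins
-- out the binomial sum. The range may overshoot `n`, since binomial coefficients vanish there, so
-- it can be rounded up to whole blocks.
⋆-sum-multiples : ∀ d m n f g → n ℕ.< suc d ℕ.* m →
  (∀ j r → r ℕ.< d → f (suc d ℕ.* j ℕ.+ suc r) ≡ 0ℤ) →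
  (f ⋆ g) n ≡ ∑< m (λ j → conv-term f g n (suc d ℕ.* j))
⋆-sum-multiples d m n f g n<dm f≡0 = begin
  (f ⋆ g) n
    ≡⟨ ⋆-sum f g n ⟩
  ∑< (suc n) (conv-term f g n)
    ≡⟨ ∑<-extend (conv-term f g n) n<dm (λ k → conv-term-vanish f g) ⟩
  ∑< (suc d ℕ.* m) (conv-term f g n)
    ≡⟨ ∑<-multiples d m (conv-term f g n) (λ j r r<d →
         trans (cong (λ x → + (n C (suc d ℕ.* j ℕ.+ suc r)) * (x * _)) (f≡0 j r r<d))
               (*-zeroʳ (+ (n C (suc d ℕ.* j ℕ.+ suc r))))) ⟩
  ∑< m (λ j → conv-term f g n (suc d ℕ.* j)) ∎

-- Exponentials and the unit of convolution.

exp : ℤ → Seq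
exp a n = a ^ n

exp-⋆-suc : ∀ a f n → (exp a ⋆ f) (suc n) ≡ a * (exp a ⋆ f) n + (exp a ⋆ D f) n
exp-⋆-suc a f n = cong (_+ (exp a ⋆ D f) n) (⊙-⋆ a (exp a) f n)

-- Both sides solve y′ = (a + b) y with y(0) = 1.
exp-+ : ∀ a b → exp a ⋆ exp b ≗ exp (a + b)
exp-+ a b zero    = refl
exp-+ a b (suc n) = begin
  ((a ⊙ exp a) ⋆ exp b) n + (exp a ⋆ (b ⊙ exp b)) n
    ≡⟨ cong₂ _+_ (⊙-⋆ a (exp a) (exp b) n) (⋆-⊙ b (exp a) (exp b) n) ⟩
  a * (exp a ⋆ exp b) n + b * (exp a ⋆ exp b) n
    ≡⟨ sym (*-distribʳ-+ _ a b) ⟩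
  (a + b) * (exp a ⋆ exp b) n
    ≡⟨ cong ((a + b) *_) (exp-+ a b n) ⟩
  (a + b) * (a + b) ^ n ∎

δ : Seq
δ zero    = 1ℤ
δ (suc _) = 0ℤ

zero-⋆ : ∀ f n → ((λ _ → 0ℤ) ⋆ f) n ≡ 0ℤ
zero-⋆ f zero    = refl
zero-⋆ f (suc n) = cong₂ _+_ (zero-⋆ f n) (zero-⋆ (D f) n)

δ-⋆ : ∀ f → δ ⋆ f ≗ f
δ-⋆ f zero    = *-identityˡ (f 0)
δ-⋆ f (suc n) = trans (cong₂ _+_ (zero-⋆ f n) (δ-⋆ (D f) n)) (+-identityˡ _)

-- `U` as the convolution inverse of 2 cosh x - 1.

n<d*[1+n/d] : ∀ n d .{{_ : ℕ.NonZero d}} → n ℕ.< d ℕ.* suc (n ℕ./ d)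
n<d*[1+n/d] n d = subst₂ ℕ._<_ (sym (ℕ.m≡m%n+[m/n]*n n d)) (ℕₚ.*-comm (suc (n ℕ./ d)) d)
  (ℕₚ.+-monoˡ-< (n ℕ./ d ℕ.* d) (ℕ.m%n<n n d))

[1+2m]/2≡m : ∀ m → suc (2 ℕ.* m) ℕ./ 2 ≡ m
[1+2m]/2≡m m = begin
  suc (2 ℕ.* m) ℕ./ 2    ≡⟨ cong (λ k → suc k ℕ./ 2) (ℕₚ.*-comm 2 m) ⟩
  suc (m ℕ.* 2) ℕ./ 2    ≡⟨ ℕ.+-distrib-/-∣ʳ 1 {d = 2} (divides-refl m) ⟩
  m ℕ.* 2 ℕ./ 2          ≡⟨ ℕ.m*n/n≡m m 2 ⟩
  m                      ∎

-- Strong induction: the recurrence at an odd index refers only to smaller odd indices.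
U-odd : ∀ m → U (suc (2 ℕ.* m)) ≡ 0ℤ
U-odd = <-rec _ λ m ih → begin
  U (suc (2 ℕ.* m))
    ≡⟨ U-rec (suc (2 ℕ.* m)) (s≤s z≤n) ⟩
  - (+ 2) * ∑< (suc (2 ℕ.* m) ℕ./ 2) (term m)
    ≡⟨ cong (λ k → - (+ 2) * ∑< k (term m)) ([1+2m]/2≡m m) ⟩
  - (+ 2) * ∑< m (term m)
    ≡⟨ cong (λ x → - (+ 2) * x) (∑<-vanish m λ i i<m → begin
         term m i
           ≡⟨ cong (λ k → + (suc (2 ℕ.* m) C (2 ℕ.* suc i)) * U k) (index m i i<m) ⟩
         + (suc (2 ℕ.* m) C (2 ℕ.* suc i)) * U (suc (2 ℕ.* (m ℕ.∸ suc i)))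
           ≡⟨ cong (λ x → + (suc (2 ℕ.* m) C (2 ℕ.* suc i)) * x) (ih (ℕₚ.∸-monoʳ-< (s≤s z≤n) i<m)) ⟩
         + (suc (2 ℕ.* m) C (2 ℕ.* suc i)) * 0ℤ
           ≡⟨ *-zeroʳ (+ (suc (2 ℕ.* m) C (2 ℕ.* suc i))) ⟩
         0ℤ ∎) ⟩
  0ℤ ∎
  where
  term : ℕ → ℕ → ℤ
  term m i = + (suc (2 ℕ.* m) C (2 ℕ.* suc i)) * U (suc (2 ℕ.* m) ℕ.∸ 2 ℕ.* suc i)

  index : ∀ m i → i ℕ.< m → suc (2 ℕ.* m) ℕ.∸ 2 ℕ.* suc i ≡ suc (2 ℕ.* (m ℕ.∸ suc i))
  index m i i<m = trans (ℕₚ.+-∸-assoc 1 (ℕₚ.*-monoʳ-≤ 2 i<m))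
                        (cong suc (sym (ℕₚ.*-distribˡ-∸ 2 m (suc i))))

exp-1-even : ∀ m → (- 1ℤ) ^ (2 ℕ.* m) ≡ 1ℤ
exp-1-even m = trans (sym (^-*-assoc (- 1ℤ) 2 m)) (^-zeroˡ m)

2cosh : Seq
2cosh = exp 1ℤ ⊕ exp (- 1ℤ)

2cosh-even : ∀ m → 2cosh (2 ℕ.* m) ≡ + 2
2cosh-even m = cong₂ _+_ (^-zeroˡ (2 ℕ.* m)) (exp-1-even m)

2cosh-odd : ∀ m → 2cosh (suc (2 ℕ.* m)) ≡ 0ℤ
2cosh-odd m = cong₂ _+_ (^-zeroˡ (suc (2 ℕ.* m))) (cong (λ x → - 1ℤ * x) (exp-1-even m))

-- Away from 0 this is `U-rec` with the missing k = 0 term restored: that term contributes 2Uₙ, and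
-- the others contribute twice the recurrence sum, which is -Uₙ. At 0 the unit `δ` accounts for the
-- initial value.
2cosh-⋆-U : 2cosh ⋆ U ≗ U ⊕ δ
2cosh-⋆-U zero        = refl
2cosh-⋆-U n@(suc n-1) = begin
  (2cosh ⋆ U) n
    ≡⟨ ⋆-sum-multiples 1 (suc (n ℕ./ 2)) n 2cosh U (n<d*[1+n/d] n 2) odd-vanish ⟩
  ∑< (suc (n ℕ./ 2)) (λ j → conv-term 2cosh U n (2 ℕ.* j))
    ≡⟨ ∑<-head (n ℕ./ 2) (λ j → conv-term 2cosh U n (2 ℕ.* j)) ⟩
  + (n C 0) * (+ 2 * U n) + ∑< (n ℕ./ 2) (λ j → conv-term 2cosh U n (2 ℕ.* suc j))
    ≡⟨ cong₂ _+_ (*-identityˡ (+ 2 * U n)) (∑<-cong (n ℕ./ 2) term) ⟩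
  + 2 * U n + ∑< (n ℕ./ 2) (λ j → + 2 * t j)
    ≡⟨ +-congˡ (+ 2 * U n) (∑<-* (n ℕ./ 2) (+ 2) t) ⟩
  + 2 * U n + + 2 * ∑< (n ℕ./ 2) t
    ≡⟨ rearrange (U n) (∑< (n ℕ./ 2) t) ⟩
  + 2 * U n - - (+ 2) * ∑< (n ℕ./ 2) t
    ≡⟨ cong (λ x → + 2 * U n - x) (sym (U-rec n (s≤s z≤n))) ⟩
  + 2 * U n - U n
    ≡⟨ finish (U n) ⟩
  U n + 0ℤ ∎
  where
  t : ℕ → ℤ
  t j = + (n C (2 ℕ.* suc j)) * U (n ℕ.∸ 2 ℕ.* suc j)

  odd-vanish : ∀ j r → r ℕ.< 1 → 2cosh (2 ℕ.* j ℕ.+ suc r) ≡ 0ℤ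
  odd-vanish j zero _ = trans (cong 2cosh (ℕₚ.+-comm (2 ℕ.* j) 1)) (2cosh-odd j)
  odd-vanish j (suc r) (s≤s ())

  pull : ∀ a b → a * (+ 2 * b) ≡ + 2 * (a * b)
  pull = solve-∀

  term : ∀ j → conv-term 2cosh U n (2 ℕ.* suc j) ≡ + 2 * t j
  term j = trans (cong (λ x → + (n C (2 ℕ.* suc j)) * (x * U (n ℕ.∸ 2 ℕ.* suc j))) (2cosh-even (suc j)))
                 (pull (+ (n C (2 ℕ.* suc j))) (U (n ℕ.∸ 2 ℕ.* suc j)))

  rearrange : ∀ a b → + 2 * a + + 2 * b ≡ + 2 * a - - (+ 2) * b
  rearrange = solve-∀

  finish : ∀ a → + 2 * a - a ≡ a + 0ℤ
  finish = solve-∀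

U-⋆-difference : ∀ f → U ⋆ (exp 1ℤ ⋆ f) ⊕ U ⋆ (exp (- 1ℤ) ⋆ f) ≗ U ⋆ f ⊕ f
U-⋆-difference f n = begin
  (U ⋆ (exp 1ℤ ⋆ f)) n + (U ⋆ (exp (- 1ℤ) ⋆ f)) n
    ≡⟨ sym (cong₂ _+_ (⋆-assoc U (exp 1ℤ) f n) (⋆-assoc U (exp (- 1ℤ)) f n)) ⟩
  ((U ⋆ exp 1ℤ) ⋆ f) n + ((U ⋆ exp (- 1ℤ)) ⋆ f) n
    ≡⟨ sym (⋆-distribʳ f (U ⋆ exp 1ℤ) (U ⋆ exp (- 1ℤ)) n) ⟩
  ((U ⋆ exp 1ℤ ⊕ U ⋆ exp (- 1ℤ)) ⋆ f) n
    ≡⟨ ⋆-cong inverse (λ _ → refl) n ⟩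
  ((U ⊕ δ) ⋆ f) n
    ≡⟨ ⋆-distribʳ f U δ n ⟩
  (U ⋆ f) n + (δ ⋆ f) n
    ≡⟨ +-congˡ ((U ⋆ f) n) (δ-⋆ f n) ⟩
  (U ⋆ f) n + f n ∎
  where
  inverse : U ⋆ exp 1ℤ ⊕ U ⋆ exp (- 1ℤ) ≗ U ⊕ δ
  inverse k = trans (sym (⋆-distribˡ U (exp 1ℤ) (exp (- 1ℤ)) k))
                    (trans (⋆-comm U 2cosh k) (2cosh-⋆-U k))

-- For fixed `n` this is a three-term relation in the exponent `a`: it is U (t² - t + 1) = t
-- multiplied by a power of t. At numerals, `1ℤ + a` and `- 1ℤ + a` compute, so instances at
-- neighbouring exponents chain directly.
U-⋆-exp : ∀ a n → (U ⋆ exp (1ℤ + a)) n + (U ⋆ exp (- 1ℤ + a)) n ≡ (U ⋆ exp a) n + a ^ n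
U-⋆-exp a n = trans
  (sym (cong₂ _+_ (⋆-cong {f = U} (λ _ → refl) (exp-+ 1ℤ a) n) (⋆-cong {f = U} (λ _ → refl) (exp-+ (- 1ℤ) a) n)))
  (U-⋆-difference (exp a) n)

exp-0 : exp 0ℤ ≗ δ
exp-0 zero    = refl
exp-0 (suc n) = refl

U-⋆-exp-0 : U ⋆ exp 0ℤ ≗ U
U-⋆-exp-0 n = trans (⋆-comm U (exp 0ℤ) n) (trans (⋆-cong exp-0 (λ _ → refl) n) (δ-⋆ U n))

U-⋆-even-sum : ∀ f m n → n ℕ.< 2 ℕ.* m → (U ⋆ f) n ≡ ∑< m (λ j → conv-term U f n (2 ℕ.* j))
U-⋆-even-sum f m n n<2m = ⋆-sum-multiples 1 m n U f n<2m odd-vanish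
  where
  odd-vanish : ∀ j r → r ℕ.< 1 → U (2 ℕ.* j ℕ.+ suc r) ≡ 0ℤ
  odd-vanish j zero _ = trans (cong U (ℕₚ.+-comm (2 ℕ.* j) 1)) (U-odd j)
  odd-vanish j (suc r) (s≤s ())

-- Second-order linear recurrences and geometric progressions.

Recurrence : ℤ → ℤ → Seq → Set
Recurrence p q f = ∀ n → f (2 ℕ.+ n) ≡ p * f (1 ℕ.+ n) + q * f n

-- A root λ of x² = p x + q becomes the root a + λ of x² = (p + 2a) x + (q − a² − p a).
exp-⋆-recurrence : ∀ a p q f → Recurrence p q f →
                   Recurrence (p + + 2 * a) (q - a * a - p * a) (exp a ⋆ f)
exp-⋆-recurrence a p q f rec n = begin
  X (2 ℕ.+ n)
    ≡⟨ exp-⋆-suc a f (1 ℕ.+ n) ⟩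
  a * X (1 ℕ.+ n) + (exp a ⋆ D f) (1 ℕ.+ n)
    ≡⟨ cong₂ (λ x y → a * x + y) (exp-⋆-suc a f n) (exp-⋆-suc a (D f) n) ⟩
  a * (a * X n + Y) + (a * Y + (exp a ⋆ D (D f)) n)
    ≡⟨ cong (λ z → a * (a * X n + Y) + (a * Y + z)) second ⟩
  a * (a * X n + Y) + (a * Y + (p * Y + q * X n))
    ≡⟨ collect a p q (X n) Y ⟩
  (p + + 2 * a) * (a * X n + Y) + (q - a * a - p * a) * X n
    ≡⟨ cong (λ x → (p + + 2 * a) * x + (q - a * a - p * a) * X n) (sym (exp-⋆-suc a f n)) ⟩
  (p + + 2 * a) * X (1 ℕ.+ n) + (q - a * a - p * a) * X n ∎
  where
  X = exp a ⋆ f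
  Y = (exp a ⋆ D f) n

  second : (exp a ⋆ D (D f)) n ≡ p * Y + q * X n
  second = begin
    (exp a ⋆ D (D f)) n                         ≡⟨ ⋆-cong {f = exp a} (λ _ → refl) rec n ⟩
    (exp a ⋆ (p ⊙ D f ⊕ q ⊙ f)) n               ≡⟨ ⋆-distribˡ (exp a) (p ⊙ D f) (q ⊙ f) n ⟩
    (exp a ⋆ (p ⊙ D f)) n + (exp a ⋆ (q ⊙ f)) n ≡⟨ cong₂ _+_ (⋆-⊙ p (exp a) (D f) n) (⋆-⊙ q (exp a) f n) ⟩
    p * Y + q * X n                             ∎

  collect : ∀ a p q x y → a * (a * x + y) + (a * y + (p * y + q * x)) ≡
                          (p + + 2 * a) * (a * x + y) + (q - a * a - p * a) * x
  collect = solve-∀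

recurrence-unique : ∀ p q {f g} → Recurrence p q f → Recurrence p q g →
                    f 0 ≡ g 0 → f 1 ≡ g 1 → f ≗ g
recurrence-unique p q rf rg f0 f1 0             = f0
recurrence-unique p q rf rg f0 f1 1             = f1
recurrence-unique p q {f} {g} rf rg f0 f1 (suc (suc n)) = begin
  f (2 ℕ.+ n)                  ≡⟨ rf n ⟩
  p * f (1 ℕ.+ n) + q * f n    ≡⟨ cong₂ (λ x y → p * x + q * y)
                                  (recurrence-unique p q rf rg f0 f1 (suc n))
                                  (recurrence-unique p q rf rg f0 f1 n) ⟩
  p * g (1 ℕ.+ n) + q * g n    ≡⟨ sym (rg n) ⟩
  g (2 ℕ.+ n)                  ∎

-- Reduces all values of a power sum to those at indices below `d`, which can be evaluated.
geometric : ∀ d q f → (∀ n → f (d ℕ.+ n) ≡ q * f n) → ∀ j r → f (d ℕ.* j ℕ.+ r) ≡ q ^ j * f r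
geometric d q f step zero r =
  trans (cong (λ k → f (k ℕ.+ r)) (ℕₚ.*-zeroʳ d)) (sym (*-identityˡ (f r)))
geometric d q f step (suc j) r = begin
  f (d ℕ.* suc j ℕ.+ r)      ≡⟨ cong (λ k → f (k ℕ.+ r)) (ℕₚ.*-suc d j) ⟩
  f (d ℕ.+ d ℕ.* j ℕ.+ r)    ≡⟨ cong f (ℕₚ.+-assoc d (d ℕ.* j) r) ⟩
  f (d ℕ.+ (d ℕ.* j ℕ.+ r))  ≡⟨ step (d ℕ.* j ℕ.+ r) ⟩
  q * f (d ℕ.* j ℕ.+ r)      ≡⟨ cong (λ x → q * x) (geometric d q f step j r) ⟩
  q * (q ^ j * f r)          ≡⟨ sym (*-assoc q (q ^ j) (f r)) ⟩
  q * q ^ j * f r            ∎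

-- Identities (i)-(iii), from the three-term relation in the exponent.

identity-i : ∀ n → ∑[ k from 0 to n ℕ./ 2 ] (+ (n C (2 ℕ.* k)) * ((+ 2) ^ (n ℕ.∸ 2 ℕ.* k) - + 1) * U (2 ℕ.* k))
             ≡ + 1 - U n
identity-i n = begin
  ∑[ k from 0 to n ℕ./ 2 ] (+ (n C (2 ℕ.* k)) * ((+ 2) ^ (n ℕ.∸ 2 ℕ.* k) - + 1) * U (2 ℕ.* k))
    ≡⟨ ∑<-cong (suc (n ℕ./ 2)) term ⟩
  ∑< (suc (n ℕ./ 2)) (λ k → conv-term U h n (2 ℕ.* k))
    ≡⟨ sym (U-⋆-even-sum h (suc (n ℕ./ 2)) n (n<d*[1+n/d] n 2)) ⟩
  (U ⋆ h) n
    ≡⟨ ⋆-distribˡ U (exp (+ 2)) (- 1ℤ ⊙ exp 1ℤ) n ⟩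
  (U ⋆ exp (+ 2)) n + (U ⋆ (- 1ℤ ⊙ exp 1ℤ)) n
    ≡⟨ +-congˡ ((U ⋆ exp (+ 2)) n) (⋆-⊙ (- 1ℤ) U (exp 1ℤ) n) ⟩
  (U ⋆ exp (+ 2)) n + - 1ℤ * (U ⋆ exp 1ℤ) n
    -- The relation at a = 1 reads U (t² + 1) = U t + t, that is U (t² - t) = t - U.
    ≡⟨ combine ((U ⋆ exp (+ 2)) n) ((U ⋆ exp 1ℤ) n) (U n) (1ℤ ^ n)
         (trans (+-congˡ ((U ⋆ exp (+ 2)) n) (sym (U-⋆-exp-0 n))) (U-⋆-exp 1ℤ n)) ⟩
  1ℤ ^ n - U n
    ≡⟨ cong (_- U n) (^-zeroˡ n) ⟩
  + 1 - U n ∎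
  where
  h : Seq
  h = exp (+ 2) ⊕ - 1ℤ ⊙ exp 1ℤ

  reorder : ∀ c a u → c * (a - + 1) * u ≡ c * (u * (a + - 1ℤ * 1ℤ))
  reorder = solve-∀

  term : ∀ k → + (n C (2 ℕ.* k)) * ((+ 2) ^ (n ℕ.∸ 2 ℕ.* k) - + 1) * U (2 ℕ.* k) ≡ conv-term U h n (2 ℕ.* k)
  term k = trans (reorder (+ (n C (2 ℕ.* k))) ((+ 2) ^ (n ℕ.∸ 2 ℕ.* k)) (U (2 ℕ.* k)))
    (cong (λ x → + (n C (2 ℕ.* k)) * (U (2 ℕ.* k) * ((+ 2) ^ (n ℕ.∸ 2 ℕ.* k) + - 1ℤ * x))) (sym (^-zeroˡ (n ℕ.∸ 2 ℕ.* k))))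

  combine : ∀ a b u e → a + u ≡ b + e → a + - 1ℤ * b ≡ e - u
  combine a b u e eq = trans (lhs a b u) (trans (cong (λ x → x - u - b) eq) (rhs b u e))
    where
    lhs : ∀ a b u → a + - 1ℤ * b ≡ a + u - u - b
    lhs = solve-∀
    rhs : ∀ b u e → b + e - u - b ≡ e - u
    rhs = solve-∀

-- Since t⁶ - 1 = (t² - t + 1)(t⁴ + t³ - t - 1), adding the relations at a = 5 and 4 and subtracting
-- those at 2 and 1 leaves U (t⁶ - 1) = t⁵ + t⁴ - t² - t.
U-⋆-exp-6 : ∀ n → (U ⋆ exp (+ 6)) n ≡ (+ 5) ^ n + (+ 4) ^ n - (+ 2) ^ n - + 1 + U n
U-⋆-exp-6 n = combine (Φ (+ 6)) (Φ (+ 5)) (Φ (+ 4)) (Φ (+ 3)) (Φ (+ 2)) (Φ (+ 1)) (U n) _ _ _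
  (U-⋆-exp (+ 5) n) (U-⋆-exp (+ 4) n) (U-⋆-exp (+ 2) n)
  (trans (+-congˡ (Φ (+ 2)) (sym (U-⋆-exp-0 n)))
         (trans (U-⋆-exp (+ 1) n) (+-congˡ (Φ (+ 1)) (^-zeroˡ n))))
  where
  Φ : ℤ → ℤ
  Φ a = (U ⋆ exp a) n

  combine : ∀ a₆ a₅ a₄ a₃ a₂ a₁ a₀ x₅ x₄ x₂ →
            a₆ + a₄ ≡ a₅ + x₅ → a₅ + a₃ ≡ a₄ + x₄ → a₃ + a₁ ≡ a₂ + x₂ → a₂ + a₀ ≡ a₁ + + 1 →
            a₆ ≡ x₅ + x₄ - x₂ - + 1 + a₀
  combine a₆ a₅ a₄ a₃ a₂ a₁ a₀ x₅ x₄ x₂ e₅ e₄ e₂ e₁ = begin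
    a₆
      ≡⟨ lhs a₆ a₅ a₄ a₃ a₂ a₁ a₀ ⟩
    (a₆ + a₄) + (a₅ + a₃) - (a₃ + a₁) - (a₂ + a₀) - a₅ - a₄ + a₂ + a₁ + a₀
      ≡⟨ cong₂ (λ x y → x - y - a₅ - a₄ + a₂ + a₁ + a₀)
           (cong₂ _-_ (cong₂ _+_ e₅ e₄) e₂) e₁ ⟩
    (a₅ + x₅) + (a₄ + x₄) - (a₂ + x₂) - (a₁ + + 1) - a₅ - a₄ + a₂ + a₁ + a₀
      ≡⟨ rhs a₅ a₄ a₂ a₁ a₀ x₅ x₄ x₂ ⟩
    x₅ + x₄ - x₂ - + 1 + a₀ ∎
    where
    lhs : ∀ a₆ a₅ a₄ a₃ a₂ a₁ a₀ →
          a₆ ≡ (a₆ + a₄) + (a₅ + a₃) - (a₃ + a₁) - (a₂ + a₀) - a₅ - a₄ + a₂ + a₁ + a₀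
    lhs = solve-∀
    rhs : ∀ a₅ a₄ a₂ a₁ a₀ x₅ x₄ x₂ →
          (a₅ + x₅) + (a₄ + x₄) - (a₂ + x₂) - (a₁ + + 1) - a₅ - a₄ + a₂ + a₁ + a₀ ≡ x₅ + x₄ - x₂ - + 1 + a₀
    rhs = solve-∀

exp-sum-term : ∀ a N k → + (N C (2 ℕ.* k)) * a ^ (N ℕ.∸ 2 ℕ.* k) * U (2 ℕ.* k) ≡ conv-term U (exp a) N (2 ℕ.* k)
exp-sum-term a N k = reorder (+ (N C (2 ℕ.* k))) (a ^ (N ℕ.∸ 2 ℕ.* k)) (U (2 ℕ.* k))
  where
  reorder : ∀ c x u → c * x * u ≡ c * (u * x)
  reorder = solve-∀

-- The term k = n/2, present in U ⋆ exp a for even n, is U n itself; for odd n that value is 0.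
U-⋆-exp-sum : ∀ a n → 1 ℕ.≤ n →
  (U ⋆ exp a) n ≡ ∑[ k from 0 to (n ℕ.∸ 1) ℕ./ 2 ] (+ (n C (2 ℕ.* k)) * a ^ (n ℕ.∸ 2 ℕ.* k) * U (2 ℕ.* k)) + U n
U-⋆-exp-sum a n@(suc m) _ = go (m ℕ.% 2) (ℕ.m%n<n m 2) (ℕ.m≡m%n+[m/n]*n m 2)
  where
  j = m ℕ./ 2
  S T : ℤ
  S = ∑< (suc j) (λ k → conv-term U (exp a) n (2 ℕ.* k))

  T = ∑[ k from 0 to j ] (+ (n C (2 ℕ.* k)) * a ^ (n ℕ.∸ 2 ℕ.* k) * U (2 ℕ.* k))

  S-eq : S ≡ T
  S-eq = sym (∑<-cong (suc j) (exp-sum-term a n))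

  go : ∀ r → r ℕ.< 2 → m ≡ r ℕ.+ j ℕ.* 2 →
       (U ⋆ exp a) n ≡ T + U n
  go 0 _ m≡ = begin
    (U ⋆ exp a) n     ≡⟨ U-⋆-even-sum (exp a) (suc j) n n<2[1+j] ⟩
    S                 ≡⟨ sym (+-identityʳ S) ⟩
    S + 0ℤ            ≡⟨ cong₂ _+_ S-eq (sym (trans (cong U n≡) (U-odd j))) ⟩
    T + U n           ∎
    where
    n≡ : n ≡ suc (2 ℕ.* j)
    n≡ = cong suc (trans m≡ (ℕₚ.*-comm j 2))

    n<2[1+j] : n ℕ.< 2 ℕ.* suc j
    n<2[1+j] = ℕₚ.≤-reflexive (trans (cong suc n≡) (sym (ℕₚ.*-suc 2 j)))
  go 1 _ m≡ = begin
    (U ⋆ exp a) n                               ≡⟨ U-⋆-even-sum (exp a) (suc (suc j)) n n<2[2+j] ⟩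
    S + conv-term U (exp a) n (2 ℕ.* suc j)     ≡⟨ cong₂ _+_ S-eq (trans (cong (conv-term U (exp a) n) (sym n≡)) last) ⟩
    T + U n                                     ∎
    where
    n≡ : n ≡ 2 ℕ.* suc j
    n≡ = trans (cong suc m≡) (trans (cong (2 ℕ.+_) (ℕₚ.*-comm j 2)) (sym (ℕₚ.*-suc 2 j)))

    n<2[2+j] : n ℕ.< 2 ℕ.* suc (suc j)
    n<2[2+j] = subst (ℕ._< 2 ℕ.* suc (suc j)) (sym n≡) (ℕₚ.*-monoʳ-< 2 (ℕₚ.n<1+n (suc j)))

    last : conv-term U (exp a) n n ≡ U n
    last = begin
      + (n C n) * (U n * a ^ (n ℕ.∸ n))  ≡⟨ cong₂ (λ c e → + c * (U n * a ^ e)) (nCn≡1 n) (ℕₚ.n∸n≡0 n) ⟩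
      1ℤ * (U n * 1ℤ)                    ≡⟨ *-identityˡ (U n * 1ℤ) ⟩
      U n * 1ℤ                           ≡⟨ *-identityʳ (U n) ⟩
      U n                                ∎
  go (suc (suc r)) (s≤s (s≤s ())) _

-- The same stray `U n` occurs in both evaluations of `U ⋆ exp (+ 6)`: once from the constant term
-- of t⁶ - 1, once from the term k = n/2 that lies beyond the summation range (0 for odd `n`). It
-- cancels.
identity-ii : ∀ n → 1 ℕ.≤ n →
  ∑[ k from 0 to (n ℕ.∸ 1) ℕ./ 2 ] (+ (n C (2 ℕ.* k)) * (+ 6) ^ (n ℕ.∸ 2 ℕ.* k) * U (2 ℕ.* k))
  ≡ (+ 5) ^ n + (+ 4) ^ n - (+ 2) ^ n - + 1
identity-ii n 1≤n = ∙-cancelʳ (U n) _ ((+ 5) ^ n + (+ 4) ^ n - (+ 2) ^ n - + 1)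
  (trans (sym (U-⋆-exp-sum (+ 6) n 1≤n)) (U-⋆-exp-6 n))

-- Two adjacent instances of the relation, added: this is t³ + 1 = (t + 1)(t² - t + 1), used both
-- for t = eˣ and for t = e⁻ˣ.
telescope : ∀ a b c u e f → a + c ≡ b + e → b + u ≡ c + f → a ≡ f + e - u
telescope a b c u e f p q = begin
  a                                  ≡⟨ lhs a b c u ⟩
  (a + c) + (b + u) - (b + c) - u    ≡⟨ cong₂ (λ x y → x + y - (b + c) - u) p q ⟩
  (b + e) + (c + f) - (b + c) - u    ≡⟨ rhs b c u e f ⟩
  f + e - u                          ∎
  where
  lhs : ∀ a b c u → a ≡ (a + c) + (b + u) - (b + c) - u
  lhs = solve-∀
  rhs : ∀ b c u e f → (b + e) + (c + f) - (b + c) - u ≡ f + e - u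
  rhs = solve-∀

U-⋆-exp-3 : ∀ n → (U ⋆ exp (+ 3)) n ≡ + 1 + (+ 2) ^ n - U n
U-⋆-exp-3 n = telescope (Φ (+ 3)) (Φ (+ 2)) (Φ (+ 1)) (U n) ((+ 2) ^ n) (+ 1)
  (U-⋆-exp (+ 2) n)
  (trans (+-congˡ (Φ (+ 2)) (sym (U-⋆-exp-0 n)))
         (trans (U-⋆-exp (+ 1) n) (+-congˡ (Φ (+ 1)) (^-zeroˡ n))))
  where
  Φ : ℤ → ℤ
  Φ a = (U ⋆ exp a) n

U-⋆-exp-neg3 : ∀ n → (U ⋆ exp (- (+ 3))) n ≡ (- (+ 1)) ^ n + (- (+ 2)) ^ n - U n
U-⋆-exp-neg3 n = telescope (Φ (- (+ 3))) (Φ (- (+ 2))) (Φ (- (+ 1))) (U n) ((- (+ 2)) ^ n) ((- (+ 1)) ^ n)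
  (trans (+-comm (Φ (- (+ 3))) (Φ (- (+ 1)))) (U-⋆-exp (- (+ 2)) n))
  (trans (+-comm (Φ (- (+ 2))) (U n))
    (trans (cong (_+ Φ (- (+ 2))) (sym (U-⋆-exp-0 n))) (U-⋆-exp (- (+ 1)) n)))
  where
  Φ : ℤ → ℤ
  Φ a = (U ⋆ exp a) n

identity-iii : ∀ n → U (2 ℕ.* n) ≡ + 1 + (+ 2) ^ (2 ℕ.* n)
  - (∑[ k from 0 to n ] (+ ((2 ℕ.* n) C (2 ℕ.* k)) * (+ 3) ^ (2 ℕ.* n ℕ.∸ 2 ℕ.* k) * U (2 ℕ.* k)))
identity-iii n = begin
  U N                                     ≡⟨ flip (U N) (+ 1 + (+ 2) ^ N) ⟩
  + 1 + (+ 2) ^ N - (+ 1 + (+ 2) ^ N - U N) ≡⟨ cong (λ x → + 1 + (+ 2) ^ N - x) (sym (U-⋆-exp-3 N)) ⟩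
  + 1 + (+ 2) ^ N - (U ⋆ exp (+ 3)) N     ≡⟨ cong (λ x → + 1 + (+ 2) ^ N - x) sum ⟩
  + 1 + (+ 2) ^ N - (∑[ k from 0 to n ] (+ (N C (2 ℕ.* k)) * (+ 3) ^ (N ℕ.∸ 2 ℕ.* k) * U (2 ℕ.* k))) ∎
  where
  N = 2 ℕ.* n

  flip : ∀ u a → u ≡ a - (a - u)
  flip = solve-∀

  sum : (U ⋆ exp (+ 3)) N ≡ ∑[ k from 0 to n ] (+ (N C (2 ℕ.* k)) * (+ 3) ^ (N ℕ.∸ 2 ℕ.* k) * U (2 ℕ.* k))
  sum = trans (U-⋆-even-sum (exp (+ 3)) (suc n) N (ℕₚ.*-monoʳ-< 2 (ℕₚ.n<1+n n)))
              (sym (∑<-cong (suc n) (exp-sum-term (+ 3) N)))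

-- Identity (iv): fourth roots of -4 and of 1.

2cos : Seq
2cos 0             = + 2
2cos 1             = 0ℤ
2cos (suc (suc n)) = - 2cos n

2cos-recurrence : Recurrence 0ℤ (- 1ℤ) 2cos
2cos-recurrence n = sym (trans (+-identityˡ (- 1ℤ * 2cos n)) (-1*i≡-i (2cos n)))

2cos-even : ∀ n → 2cos (2 ℕ.* n) ≡ + 2 * (- (+ 1)) ^ n
2cos-even zero    = refl
2cos-even (suc n) = begin
  2cos (2 ℕ.* suc n)            ≡⟨ cong 2cos (ℕₚ.*-suc 2 n) ⟩
  - 2cos (2 ℕ.* n)              ≡⟨ cong -_ (2cos-even n) ⟩
  - (+ 2 * (- (+ 1)) ^ n)       ≡⟨ reorder ((- (+ 1)) ^ n) ⟩
  + 2 * (- (+ 1) * (- (+ 1)) ^ n) ∎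
  where
  reorder : ∀ x → - (+ 2 * x) ≡ + 2 * (- (+ 1) * x)
  reorder = solve-∀

-- If x² = p x + q, then x³ = (p² + q) x + p q, so both characteristic roots have cube p q.
recurrence-3 : ∀ p q f → p * p + q ≡ 0ℤ → Recurrence p q f → ∀ n → f (3 ℕ.+ n) ≡ p * q * f n
recurrence-3 p q f p²+q≡0 rec n = begin
  f (3 ℕ.+ n)                                          ≡⟨ rec (suc n) ⟩
  p * f (2 ℕ.+ n) + q * f (1 ℕ.+ n)                    ≡⟨ cong (λ x → p * x + q * f (1 ℕ.+ n)) (rec n) ⟩
  p * (p * f (1 ℕ.+ n) + q * f n) + q * f (1 ℕ.+ n)    ≡⟨ collect p q (f (1 ℕ.+ n)) (f n) ⟩
  (p * p + q) * f (1 ℕ.+ n) + p * q * f n              ≡⟨ cong (λ x → x * f (1 ℕ.+ n) + p * q * f n) p²+q≡0 ⟩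
  0ℤ * f (1 ℕ.+ n) + p * q * f n                       ≡⟨ +-identityˡ _ ⟩
  p * q * f n                                          ∎
  where
  collect : ∀ p q y x → p * (p * y + q * x) + q * y ≡ (p * p + q) * y + p * q * x
  collect = solve-∀

-- Squaring x² - q = p x gives x⁴ = (p² + 2q) x² - q², so both characteristic roots have fourth
-- power -q².
recurrence-4 : ∀ p q f → p * p + + 2 * q ≡ 0ℤ → Recurrence p q f → ∀ n → f (4 ℕ.+ n) ≡ - (q * q) * f n
recurrence-4 p q f p²+2q≡0 rec n = begin
  f (4 ℕ.+ n)
    ≡⟨ rec (2 ℕ.+ n) ⟩
  p * f (3 ℕ.+ n) + q * f (2 ℕ.+ n)
    ≡⟨ cong (λ x → p * x + q * f (2 ℕ.+ n)) (rec (1 ℕ.+ n)) ⟩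
  p * (p * f (2 ℕ.+ n) + q * f (1 ℕ.+ n)) + q * f (2 ℕ.+ n)
    ≡⟨ cong (λ x → p * (p * x + q * f (1 ℕ.+ n)) + q * x) (rec n) ⟩
  p * (p * (p * f (1 ℕ.+ n) + q * f n) + q * f (1 ℕ.+ n)) + q * (p * f (1 ℕ.+ n) + q * f n)
    ≡⟨ collect p q (f (1 ℕ.+ n)) (f n) ⟩
  (p * p + + 2 * q) * (p * f (1 ℕ.+ n) + q * f n) + - (q * q) * f n
    ≡⟨ cong (λ x → x * (p * f (1 ℕ.+ n) + q * f n) + - (q * q) * f n) p²+2q≡0 ⟩
  0ℤ * (p * f (1 ℕ.+ n) + q * f n) + - (q * q) * f n
    ≡⟨ +-identityˡ _ ⟩
  - (q * q) * f n ∎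
  where
  collect : ∀ p q y x → p * (p * (p * y + q * x) + q * y) + q * (p * y + q * x) ≡
                        (p * p + + 2 * q) * (p * y + q * x) + - (q * q) * x
  collect = solve-∀

-- By the shift relation `G ⋆ U` is 2cos ⋆ U + 2cos, while `H ⋆ U` is U + δ + 2cos ⋆ U. The
-- difference `K` eliminates the unwanted product `2cos ⋆ U` and is still supported on multiples of
-- 4.
identity-iv : ∀ n → 1 ℕ.≤ n → U (2 ℕ.* n) ≡ + 2 * (- (+ 1)) ^ n
  - + 4 * (∑[ k from 1 to n ℕ./ 2 ] (+ ((2 ℕ.* n) C (4 ℕ.* k)) * ((- (+ 4)) ^ k - + 1) * U (2 ℕ.* n ℕ.∸ 4 ℕ.* k)))
identity-iv n@(suc n-1) _ = begin
  U N
    ≡⟨ flip (U N) (2cos N) ⟩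
  2cos N - (2cos N - U N)
    ≡⟨ cong₂ _-_ (2cos-even n) (sym K⋆U) ⟩
  + 2 * (- (+ 1)) ^ n - (K ⋆ U) N
    ≡⟨ cong (λ x → + 2 * (- (+ 1)) ^ n - x) sum ⟩
  + 2 * (- (+ 1)) ^ n - + 4 * ∑< (n ℕ./ 2) (λ k → t (suc k)) ∎
  where
  N = 2 ℕ.* n

  flip : ∀ u a → u ≡ a - (a - u)
  flip = solve-∀

  -- G n is the sum of the n-th powers of ±1 ± i, the fourth roots of −4, and H n that of the fourth roots of 1.
  G H K : Seq
  G = exp 1ℤ ⋆ 2cos ⊕ exp (- 1ℤ) ⋆ 2cos
  H = 2cosh ⊕ 2cos
  K = G ⊕ - 1ℤ ⊙ H

  G-step : ∀ m → G (4 ℕ.+ m) ≡ - (+ 4) * G m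
  G-step m = trans (cong₂ _+_
      (recurrence-4 (+ 2) (- (+ 2)) (exp 1ℤ ⋆ 2cos) refl (exp-⋆-recurrence 1ℤ 0ℤ (- 1ℤ) 2cos 2cos-recurrence) m)
      (recurrence-4 (- (+ 2)) (- (+ 2)) (exp (- 1ℤ) ⋆ 2cos) refl (exp-⋆-recurrence (- 1ℤ) 0ℤ (- 1ℤ) 2cos 2cos-recurrence) m))
    (sym (*-distribˡ-+ (- (+ 4)) ((exp 1ℤ ⋆ 2cos) m) ((exp (- 1ℤ) ⋆ 2cos) m)))

  H-step : ∀ m → H (4 ℕ.+ m) ≡ 1ℤ * H m
  H-step m = period (1ℤ ^ m) ((- 1ℤ) ^ m) (2cos m)
    where
    period : ∀ x y z → 1ℤ * (1ℤ * (1ℤ * (1ℤ * x))) + (- 1ℤ) * ((- 1ℤ) * ((- 1ℤ) * ((- 1ℤ) * y))) + (- - z) ≡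
                       1ℤ * (x + y + z)
    period = solve-∀

  K-eq : ∀ j r → K (4 ℕ.* j ℕ.+ r) ≡ (- (+ 4)) ^ j * G r + - 1ℤ * H r
  K-eq j r = cong₂ (λ x y → x + - 1ℤ * y) (geometric 4 (- (+ 4)) G G-step j r)
    (trans (geometric 4 1ℤ H H-step j r) (trans (cong (_* H r) (^-zeroˡ j)) (*-identityˡ (H r))))

  K-multiple : ∀ j → K (4 ℕ.* j) ≡ + 4 * ((- (+ 4)) ^ j - + 1)
  K-multiple j = trans (cong K (sym (ℕₚ.+-identityʳ (4 ℕ.* j))))
    (trans (K-eq j 0) (factor ((- (+ 4)) ^ j)))
    where
    factor : ∀ x → x * + 4 + - 1ℤ * + 4 ≡ + 4 * (x - + 1)
    factor = solve-∀

  K-vanish : ∀ j r → r ℕ.< 3 → K (4 ℕ.* j ℕ.+ suc r) ≡ 0ℤ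
  -- `G` and `H` evaluate to 0 at 1, 2 and 3; only the product with the symbolic power of -4 needs a
  -- lemma.
  K-vanish j 0 _ = trans (K-eq j 1) (cong (_+ 0ℤ) (*-zeroʳ ((- (+ 4)) ^ j)))
  K-vanish j 1 _ = trans (K-eq j 2) (cong (_+ 0ℤ) (*-zeroʳ ((- (+ 4)) ^ j)))
  K-vanish j 2 _ = trans (K-eq j 3) (cong (_+ 0ℤ) (*-zeroʳ ((- (+ 4)) ^ j)))
  K-vanish j (suc (suc (suc r))) (s≤s (s≤s (s≤s ())))

  K⋆U : (K ⋆ U) N ≡ 2cos N - U N
  K⋆U = begin
    (K ⋆ U) N
      ≡⟨ ⋆-distribʳ U G (- 1ℤ ⊙ H) N ⟩
    (G ⋆ U) N + ((- 1ℤ ⊙ H) ⋆ U) N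
      ≡⟨ cong₂ _+_ G⋆U (trans (⊙-⋆ (- 1ℤ) H U N) (cong (λ x → - 1ℤ * x) (⋆-distribʳ U 2cosh 2cos N))) ⟩
    (2cos ⋆ U) N + 2cos N + - 1ℤ * ((2cosh ⋆ U) N + (2cos ⋆ U) N)
      -- Here `δ N` computes to 0 because `n` was matched as a successor.
      ≡⟨ cong (λ x → (2cos ⋆ U) N + 2cos N + - 1ℤ * (x + (2cos ⋆ U) N)) (2cosh-⋆-U N) ⟩
    (2cos ⋆ U) N + 2cos N + - 1ℤ * (U N + 0ℤ + (2cos ⋆ U) N)
      ≡⟨ cancel ((2cos ⋆ U) N) (2cos N) (U N) ⟩
    2cos N - U N ∎
    where
    cancel : ∀ w c u → w + c + - 1ℤ * (u + 0ℤ + w) ≡ c - u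
    cancel = solve-∀

    G⋆U : (G ⋆ U) N ≡ (2cos ⋆ U) N + 2cos N
    G⋆U = begin
      (G ⋆ U) N                     ≡⟨ ⋆-comm G U N ⟩
      (U ⋆ G) N                     ≡⟨ ⋆-distribˡ U (exp 1ℤ ⋆ 2cos) (exp (- 1ℤ) ⋆ 2cos) N ⟩
      (U ⋆ (exp 1ℤ ⋆ 2cos)) N + (U ⋆ (exp (- 1ℤ) ⋆ 2cos)) N
                                    ≡⟨ U-⋆-difference 2cos N ⟩
      (U ⋆ 2cos) N + 2cos N         ≡⟨ cong (_+ 2cos N) (⋆-comm U 2cos N) ⟩
      (2cos ⋆ U) N + 2cos N         ∎

  t : Seq
  t k = + (N C (4 ℕ.* k)) * ((- (+ 4)) ^ k - + 1) * U (N ℕ.∸ 4 ℕ.* k)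

  term : ∀ k → conv-term K U N (4 ℕ.* k) ≡ + 4 * t k
  term k = trans (cong (λ x → + (N C (4 ℕ.* k)) * (x * U (N ℕ.∸ 4 ℕ.* k))) (K-multiple k))
                 (reorder (+ (N C (4 ℕ.* k))) ((- (+ 4)) ^ k) (U (N ℕ.∸ 4 ℕ.* k)))
    where
    reorder : ∀ c x u → c * (+ 4 * (x - + 1) * u) ≡ + 4 * (c * (x - + 1) * u)
    reorder = solve-∀

  N<4[1+n/2] : N ℕ.< 4 ℕ.* suc (n ℕ./ 2)
  N<4[1+n/2] = subst (N ℕ.<_) (sym (ℕₚ.*-assoc 2 2 (suc (n ℕ./ 2)))) (ℕₚ.*-monoʳ-< 2 (n<d*[1+n/d] n 2))

  sum : (K ⋆ U) N ≡ + 4 * ∑< (n ℕ./ 2) (t ∘ suc)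
  sum = begin
    (K ⋆ U) N
      ≡⟨ ⋆-sum-multiples 3 (suc (n ℕ./ 2)) N K U N<4[1+n/2] K-vanish ⟩
    ∑< (suc (n ℕ./ 2)) (λ k → conv-term K U N (4 ℕ.* k))
      ≡⟨ ∑<-cong (suc (n ℕ./ 2)) term ⟩
    ∑< (suc (n ℕ./ 2)) (λ k → + 4 * t k)
      ≡⟨ ∑<-* (suc (n ℕ./ 2)) (+ 4) t ⟩
    + 4 * ∑< (suc (n ℕ./ 2)) t
      -- The k = 0 term vanishes because (-4)⁰ - 1 = 0, so the sum starts at 1.
      ≡⟨ cong (λ x → + 4 * x) (∑<-head (n ℕ./ 2) t) ⟩
    + 4 * (0ℤ + ∑< (n ℕ./ 2) (t ∘ suc))
      ≡⟨ cong (λ x → + 4 * x) (+-identityˡ (∑< (n ℕ./ 2) (t ∘ suc))) ⟩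
    + 4 * ∑< (n ℕ./ 2) (t ∘ suc) ∎

-- Identity (v): sixth roots of 3⁶.

V-recurrence : Recurrence (+ 1) (- (+ 7)) V
V-recurrence n = reorder (V (suc n)) (V n)
  where
  reorder : ∀ a b → a - + 7 * b ≡ + 1 * a + - (+ 7) * b
  reorder = solve-∀

V⁻ : Seq
V⁻ = exp (- 1ℤ) ⋆ V

V⁻-recurrence : Recurrence (- (+ 1)) (- (+ 7)) V⁻
V⁻-recurrence = exp-⋆-recurrence (- 1ℤ) (+ 1) (- (+ 7)) V V-recurrence

-- The characteristic roots of `V` add up to 1, so subtracting 1 from each turns the pair into its
-- negatives.
V⁻-sign : ∀ n → V⁻ n ≡ (- 1ℤ) ^ n * V n
V⁻-sign = recurrence-unique (- (+ 1)) (- (+ 7)) V⁻-recurrence alternate refl refl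
  where
  alternate : Recurrence (- (+ 1)) (- (+ 7)) (λ n → (- 1ℤ) ^ n * V n)
  alternate n = expand ((- 1ℤ) ^ n) (V (suc n)) (V n)
    where
    expand : ∀ s a b → - 1ℤ * (- 1ℤ * s) * (a - + 7 * b) ≡ - (+ 1) * (- 1ℤ * s * a) + - (+ 7) * (s * b)
    expand = solve-∀

exp-⋆-V⁻ : exp 1ℤ ⋆ V⁻ ≗ V
exp-⋆-V⁻ n = begin
  (exp 1ℤ ⋆ V⁻) n                   ≡⟨ sym (⋆-assoc (exp 1ℤ) (exp (- 1ℤ)) V n) ⟩
  ((exp 1ℤ ⋆ exp (- 1ℤ)) ⋆ V) n     ≡⟨ ⋆-cong (λ k → trans (exp-+ 1ℤ (- 1ℤ) k) (exp-0 k)) (λ _ → refl) n ⟩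
  (δ ⋆ V) n                         ≡⟨ δ-⋆ V n ⟩
  V n                               ∎

-- The sum of the n-th powers of the sixth roots of 3⁶: the roots of x² = x − 7 shifted by 1 and by −2, and ±3.
sixth-roots : Seq
sixth-roots = (exp 1ℤ ⋆ V ⊕ exp (- 1ℤ) ⋆ V⁻) ⊕ (exp (+ 3) ⊕ exp (- (+ 3)))

-- The two shifted pairs satisfy x² = 3x - 9 and x² = -3x - 9, hence have cubes -27 and 27; two
-- steps of three multiply either by 729.
sixth-roots-step : ∀ n → sixth-roots (6 ℕ.+ n) ≡ (+ 3) ^ 6 * sixth-roots n
sixth-roots-step n = trans
  (cong₂ (λ x y → x + y + ((+ 3) ^ (6 ℕ.+ n) + (- (+ 3)) ^ (6 ℕ.+ n)))
    (trans (step₁ (3 ℕ.+ n)) (cong (λ x → + 3 * - (+ 9) * x) (step₁ n)))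
    (trans (step₂ (3 ℕ.+ n)) (cong (λ x → - (+ 3) * - (+ 9) * x) (step₂ n))))
  (collect ((exp 1ℤ ⋆ V) n) ((exp (- 1ℤ) ⋆ V⁻) n) ((+ 3) ^ n) ((- (+ 3)) ^ n))
  where
  step₁ : ∀ m → (exp 1ℤ ⋆ V) (3 ℕ.+ m) ≡ + 3 * - (+ 9) * (exp 1ℤ ⋆ V) m
  step₁ = recurrence-3 (+ 3) (- (+ 9)) (exp 1ℤ ⋆ V) refl
    (exp-⋆-recurrence 1ℤ (+ 1) (- (+ 7)) V V-recurrence)

  step₂ : ∀ m → (exp (- 1ℤ) ⋆ V⁻) (3 ℕ.+ m) ≡ - (+ 3) * - (+ 9) * (exp (- 1ℤ) ⋆ V⁻) m
  step₂ = recurrence-3 (- (+ 3)) (- (+ 9)) (exp (- 1ℤ) ⋆ V⁻) refl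
    (exp-⋆-recurrence (- 1ℤ) (- (+ 1)) (- (+ 7)) V⁻ V⁻-recurrence)

  collect : ∀ x y a b →
    + 3 * - (+ 9) * (+ 3 * - (+ 9) * x) + - (+ 3) * - (+ 9) * (- (+ 3) * - (+ 9) * y) +
    (+ 3 * (+ 3 * (+ 3 * (+ 3 * (+ 3 * (+ 3 * a))))) +
     - (+ 3) * (- (+ 3) * (- (+ 3) * (- (+ 3) * (- (+ 3) * (- (+ 3) * b))))))
    ≡ + 729 * (x + y + (a + b))
  collect = solve-∀

sixth-roots-multiple : ∀ k → sixth-roots (6 ℕ.* k) ≡ + 6 * (+ 3) ^ (6 ℕ.* k)
sixth-roots-multiple k = begin
  sixth-roots (6 ℕ.* k)           ≡⟨ cong sixth-roots (sym (ℕₚ.+-identityʳ (6 ℕ.* k))) ⟩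
  sixth-roots (6 ℕ.* k ℕ.+ 0)     ≡⟨ geometric 6 ((+ 3) ^ 6) sixth-roots sixth-roots-step k 0 ⟩
  ((+ 3) ^ 6) ^ k * + 6           ≡⟨ *-comm (((+ 3) ^ 6) ^ k) (+ 6) ⟩
  + 6 * ((+ 3) ^ 6) ^ k           ≡⟨ cong (λ x → + 6 * x) (^-*-assoc (+ 3) 6 k) ⟩
  + 6 * (+ 3) ^ (6 ℕ.* k)         ∎

sixth-roots-vanish : ∀ j r → r ℕ.< 5 → sixth-roots (6 ℕ.* j ℕ.+ suc r) ≡ 0ℤ
sixth-roots-vanish j r r<5 = trans (geometric 6 ((+ 3) ^ 6) sixth-roots sixth-roots-step j (suc r))
  (trans (cong (λ x → ((+ 3) ^ 6) ^ j * x) (initial r r<5)) (*-zeroʳ (((+ 3) ^ 6) ^ j)))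
  where
  initial : ∀ r → r ℕ.< 5 → sixth-roots (suc r) ≡ 0ℤ
  initial 0 _ = refl
  initial 1 _ = refl
  initial 2 _ = refl
  initial 3 _ = refl
  initial 4 _ = refl
  initial (suc (suc (suc (suc (suc r))))) (s≤s (s≤s (s≤s (s≤s (s≤s ())))))

-- The pairs contribute through the shift relation for `V` and `V⁻`, the roots ±3 through the
-- evaluations at exponents 3 and -3. The even index removes all signs.
U-⋆-sixth-roots : ∀ n → let N = 2 ℕ.* n in
  (U ⋆ sixth-roots) N ≡ + 2 * (V N + (+ 4) ^ n + + 1 - U N)
U-⋆-sixth-roots n = begin
  (U ⋆ sixth-roots) N
    ≡⟨ ⋆-distribˡ U (exp 1ℤ ⋆ V ⊕ exp (- 1ℤ) ⋆ V⁻) (exp (+ 3) ⊕ exp (- (+ 3))) N ⟩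
  (U ⋆ (exp 1ℤ ⋆ V ⊕ exp (- 1ℤ) ⋆ V⁻)) N + (U ⋆ (exp (+ 3) ⊕ exp (- (+ 3)))) N
    ≡⟨ cong₂ _+_ V-part exp-part ⟩
  (V N + V N) + ((+ 1 + (+ 4) ^ n - U N) + (+ 1 + (+ 4) ^ n - U N))
    ≡⟨ double (V N) ((+ 4) ^ n) (U N) ⟩
  + 2 * (V N + (+ 4) ^ n + + 1 - U N) ∎
  where
  N = 2 ℕ.* n

  double : ∀ v x u → (v + v) + ((+ 1 + x - u) + (+ 1 + x - u)) ≡ + 2 * (v + x + + 1 - u)
  double = solve-∀

  V-part : (U ⋆ (exp 1ℤ ⋆ V ⊕ exp (- 1ℤ) ⋆ V⁻)) N ≡ V N + V N
  V-part = begin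
    (U ⋆ (exp 1ℤ ⋆ V ⊕ exp (- 1ℤ) ⋆ V⁻)) N
      ≡⟨ ⋆-distribˡ U (exp 1ℤ ⋆ V) (exp (- 1ℤ) ⋆ V⁻) N ⟩
    (U ⋆ (exp 1ℤ ⋆ V)) N + (U ⋆ (exp (- 1ℤ) ⋆ V⁻)) N
      -- Multiplication by e⁻ˣ sends `V` to `V⁻`, and eˣ sends it back. Each instance of the
      -- relation thus contains both `U ⋆ V` and `U ⋆ V⁻`, on opposite sides, and they cancel in the
      -- sum.
      ≡⟨ add ((U ⋆ (exp 1ℤ ⋆ V)) N) ((U ⋆ V⁻) N) ((U ⋆ V) N) ((U ⋆ (exp (- 1ℤ) ⋆ V⁻)) N) (V N) (V⁻ N)
             (U-⋆-difference V N)
             (trans (cong (_+ (U ⋆ (exp (- 1ℤ) ⋆ V⁻)) N) (⋆-cong {f = U} (λ _ → refl) (sym ∘ exp-⋆-V⁻) N))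
                    (U-⋆-difference V⁻ N)) ⟩
    V N + V⁻ N
      ≡⟨ +-congˡ (V N) (trans (V⁻-sign N) (trans (cong (_* V N) (exp-1-even n)) (*-identityˡ (V N)))) ⟩
    V N + V N ∎
    where
    add : ∀ x z v y s t → x + z ≡ v + s → v + y ≡ z + t → x + y ≡ s + t
    add x z v y s t p q = begin
      x + y                        ≡⟨ lhs x y z v ⟩
      (x + z) + (v + y) - z - v    ≡⟨ cong₂ (λ a b → a + b - z - v) p q ⟩
      (v + s) + (z + t) - z - v    ≡⟨ rhs s t z v ⟩
      s + t                        ∎
      where
      lhs : ∀ x y z v → x + y ≡ (x + z) + (v + y) - z - v
      lhs = solve-∀
      rhs : ∀ s t z v → (v + s) + (z + t) - z - v ≡ s + t
      rhs = solve-∀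

  exp-part : (U ⋆ (exp (+ 3) ⊕ exp (- (+ 3)))) N ≡ (+ 1 + (+ 4) ^ n - U N) + (+ 1 + (+ 4) ^ n - U N)
  exp-part = trans (⋆-distribˡ U (exp (+ 3)) (exp (- (+ 3))) N) (cong₂ _+_
    (trans (U-⋆-exp-3 N) (cong (λ x → + 1 + x - U N) (sym (^-*-assoc (+ 2) 2 n))))
    (trans (U-⋆-exp-neg3 N) (cong₂ (λ x y → x + y - U N) (exp-1-even n) (sym (^-*-assoc (- (+ 2)) 2 n)))))

4×identity-v : ∀ n → 1 ℕ.≤ n → + 4 * U (2 ℕ.* n) ≡ + 4 * (+ 4) ^ (n ℕ.∸ 1) + (+ 1 + V (2 ℕ.* n))
  - + 3 * (∑[ k from 1 to n ℕ./ 3 ] (+ ((2 ℕ.* n) C (6 ℕ.* k)) * (+ 3) ^ (6 ℕ.* k) * U (2 ℕ.* n ℕ.∸ 6 ℕ.* k)))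
-- Matching on the successor makes `+ 4 * (+ 4) ^ (n ℕ.∸ 1)` compute to `(+ 4) ^ n`. Equating the
-- two evaluations of the convolution gives twice the claim.
4×identity-v n@(suc n-1) _ = *-cancelˡ-≡ (+ 2) (+ 4 * U N) _
  (combine (U N) (V N) ((+ 4) ^ n) (∑< (n ℕ./ 3) (t ∘ suc)) (trans (sym sum) (U-⋆-sixth-roots n)))
  where
  N = 2 ℕ.* n

  t : Seq
  t k = + (N C (6 ℕ.* k)) * (+ 3) ^ (6 ℕ.* k) * U (N ℕ.∸ 6 ℕ.* k)

  term : ∀ k → conv-term sixth-roots U N (6 ℕ.* k) ≡ + 6 * t k
  term k = trans (cong (λ x → + (N C (6 ℕ.* k)) * (x * U (N ℕ.∸ 6 ℕ.* k))) (sixth-roots-multiple k))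
                 (reorder (+ (N C (6 ℕ.* k))) ((+ 3) ^ (6 ℕ.* k)) (U (N ℕ.∸ 6 ℕ.* k)))
    where
    reorder : ∀ c x u → c * (+ 6 * x * u) ≡ + 6 * (c * x * u)
    reorder = solve-∀

  N<6[1+n/3] : N ℕ.< 6 ℕ.* suc (n ℕ./ 3)
  N<6[1+n/3] = subst (N ℕ.<_) (sym (ℕₚ.*-assoc 2 3 (suc (n ℕ./ 3)))) (ℕₚ.*-monoʳ-< 2 (n<d*[1+n/d] n 3))

  sum : (U ⋆ sixth-roots) N ≡ + 6 * (U N + ∑< (n ℕ./ 3) (t ∘ suc))
  sum = begin
    (U ⋆ sixth-roots) N
      ≡⟨ ⋆-comm U sixth-roots N ⟩
    (sixth-roots ⋆ U) N
      ≡⟨ ⋆-sum-multiples 5 (suc (n ℕ./ 3)) N sixth-roots U N<6[1+n/3] sixth-roots-vanish ⟩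
    ∑< (suc (n ℕ./ 3)) (λ k → conv-term sixth-roots U N (6 ℕ.* k))
      ≡⟨ ∑<-cong (suc (n ℕ./ 3)) term ⟩
    ∑< (suc (n ℕ./ 3)) (λ k → + 6 * t k)
      ≡⟨ ∑<-* (suc (n ℕ./ 3)) (+ 6) t ⟩
    + 6 * ∑< (suc (n ℕ./ 3)) t
      -- The k = 0 term is U at `N` itself; its 6 copies join 2 from the other evaluation to give
      -- the 8 = 2 · 4 that `combine` collects.
      ≡⟨ cong (λ x → + 6 * x) (∑<-head (n ℕ./ 3) t) ⟩
    + 6 * (1ℤ * U N + ∑< (n ℕ./ 3) (t ∘ suc))
      ≡⟨ cong (λ x → + 6 * (x + ∑< (n ℕ./ 3) (t ∘ suc))) (*-identityˡ (U N)) ⟩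
    + 6 * (U N + ∑< (n ℕ./ 3) (t ∘ suc)) ∎

  combine : ∀ u v x s → + 6 * (u + s) ≡ + 2 * (v + x + + 1 - u) →
            + 2 * (+ 4 * u) ≡ + 2 * (x + (+ 1 + v) - + 3 * s)
  combine u v x s eq = begin
    + 2 * (+ 4 * u)                                ≡⟨ lhs u s ⟩
    + 6 * (u + s) + + 2 * u - + 6 * s              ≡⟨ cong (λ y → y + + 2 * u - + 6 * s) eq ⟩
    + 2 * (v + x + + 1 - u) + + 2 * u - + 6 * s    ≡⟨ rhs u v x s ⟩
    + 2 * (x + (+ 1 + v) - + 3 * s)                ∎
    where
    lhs : ∀ u s → + 2 * (+ 4 * u) ≡ + 6 * (u + s) + + 2 * u - + 6 * s
    lhs = solve-∀
    rhs : ∀ u v x s → + 2 * (v + x + + 1 - u) + + 2 * u - + 6 * s ≡ + 2 * (x + (+ 1 + v) - + 3 * s)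
    rhs = solve-∀

-- Both sides are compared as unnormalised fractions, which avoids common divisors and leaves one
-- integer identity by cross-multiplication.
divide-by-4 : ∀ u a b s → + 4 * u ≡ + 4 * a + b - + 3 * s →
              u / 1 ≡ a / 1 ℚ.+ b / 4 ℚ.- (+ 3 / 4) ℚ.* (s / 1)
divide-by-4 u a b s eq = ℚₚ.toℚᵘ-injective
  (ℚᵘₚ.≃-trans (ℚₚ.toℚᵘ-fromℚᵘ (mkℚᵘ u 0)) (ℚᵘₚ.≃-trans (*≡* cross) (ℚᵘₚ.≃-sym unnormalise)))
  where
  unnormalise : toℚᵘ (a / 1 ℚ.+ b / 4 ℚ.- (+ 3 / 4) ℚ.* (s / 1)) ≃
                mkℚᵘ a 0 ℚᵘ.+ mkℚᵘ b 3 ℚᵘ.- mkℚᵘ (+ 3) 3 ℚᵘ.* mkℚᵘ s 0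
  unnormalise = ℚᵘₚ.≃-trans (ℚₚ.toℚᵘ-homo-+ (a / 1 ℚ.+ b / 4) (ℚ.- ((+ 3 / 4) ℚ.* (s / 1))))
    (ℚᵘₚ.+-cong
      (ℚᵘₚ.≃-trans (ℚₚ.toℚᵘ-homo-+ (a / 1) (b / 4))
        (ℚᵘₚ.+-cong (ℚₚ.toℚᵘ-fromℚᵘ (mkℚᵘ a 0)) (ℚₚ.toℚᵘ-fromℚᵘ (mkℚᵘ b 3))))
      (ℚᵘₚ.≃-trans (ℚₚ.toℚᵘ-homo‿- ((+ 3 / 4) ℚ.* (s / 1)))
        (ℚᵘₚ.-‿cong (ℚᵘₚ.≃-trans (ℚₚ.toℚᵘ-homo-* (+ 3 / 4) (s / 1))
          (ℚᵘₚ.*-congˡ {toℚᵘ (+ 3 / 4)} (ℚₚ.toℚᵘ-fromℚᵘ (mkℚᵘ s 0)))))))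

  -- The right-hand side has unreduced denominator 4 · 4 = 16, and `u / 1` has denominator 1.
  cross : u * + 16 ≡ ((a * + 4 + b * + 1) * + 4 + - (+ 3 * s) * + 4) * + 1
  cross = begin
    u * + 16                                                ≡⟨ lhs u ⟩
    + 4 * (+ 4 * u)                                         ≡⟨ cong (λ x → + 4 * x) eq ⟩
    + 4 * (+ 4 * a + b - + 3 * s)                           ≡⟨ rhs a b s ⟩
    ((a * + 4 + b * + 1) * + 4 + - (+ 3 * s) * + 4) * + 1   ∎
    where
    lhs : ∀ u → u * + 16 ≡ + 4 * (+ 4 * u)
    lhs = solve-∀
    rhs : ∀ a b s → + 4 * (+ 4 * a + b - + 3 * s) ≡ ((a * + 4 + b * + 1) * + 4 + - (+ 3 * s) * + 4) * + 1
    rhs = solve-∀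

theorem2p4 : (n : ℕ) → 1 ℕ.≤ n →
    (∑[ k from 0 to n ℕ./ 2 ] (+ (n C (2 ℕ.* k)) * ((+ 2) ^ (n ℕ.∸ 2 ℕ.* k) - + 1) * U (2 ℕ.* k))
      ≡ + 1 - U n)
  × (∑[ k from 0 to (n ℕ.∸ 1) ℕ./ 2 ] (+ (n C (2 ℕ.* k)) * (+ 6) ^ (n ℕ.∸ 2 ℕ.* k) * U (2 ℕ.* k))
      ≡ (+ 5) ^ n + (+ 4) ^ n - (+ 2) ^ n - + 1)
  × (U (2 ℕ.* n)
      ≡ + 1 + (+ 2) ^ (2 ℕ.* n)
        - (∑[ k from 0 to n ] (+ ((2 ℕ.* n) C (2 ℕ.* k)) * (+ 3) ^ (2 ℕ.* n ℕ.∸ 2 ℕ.* k) * U (2 ℕ.* k))))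
  × (U (2 ℕ.* n)
      ≡ + 2 * (- (+ 1)) ^ n
        - + 4 * (∑[ k from 1 to n ℕ./ 2 ] (+ ((2 ℕ.* n) C (4 ℕ.* k)) * ((- (+ 4)) ^ k - + 1) * U (2 ℕ.* n ℕ.∸ 4 ℕ.* k))))
  × (U (2 ℕ.* n) / 1
      ≡ ((+ 4) ^ (n ℕ.∸ 1)) / 1 ℚ.+ (+ 1 + V (2 ℕ.* n)) / 4
        ℚ.- (+ 3 / 4) ℚ.* ((∑[ k from 1 to n ℕ./ 3 ] (+ ((2 ℕ.* n) C (6 ℕ.* k)) * (+ 3) ^ (6 ℕ.* k) * U (2 ℕ.* n ℕ.∸ 6 ℕ.* k))) / 1))
theorem2p4 n 1≤n = identity-i n , identity-ii n 1≤n , identity-iii n , identity-iv n 1≤n ,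
  divide-by-4 (U (2 ℕ.* n)) ((+ 4) ^ (n ℕ.∸ 1)) (+ 1 + V (2 ℕ.* n))
    (∑[ k from 1 to n ℕ./ 3 ] (+ ((2 ℕ.* n) C (6 ℕ.* k)) * (+ 3) ^ (6 ℕ.* k) * U (2 ℕ.* n ℕ.∸ 6 ℕ.* k)))
    (4×identity-v n 1≤n)
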